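{- Let $u(n)$, $n \ge 0$, be the version of the Thue-Morse sequence with $u(n) = 1$ if $s_2(n)$ is even and $u(n)=2$ if $s_2(n)$ is odd, and let $c(n) = \sum_{i=0}^n u(i)\,u(n-i)$ be its convolution with itself. Then $c(n) \equiv m(n) \pmod 2$ for all $n \ge 0$.
   Context: For a non-negative integer $k$, $s_2(k)$ denotes the number of ones in the binary expansion of $k$. Define $\bar{t}(k) = 1$ if $s_2(k)$ is even and $\bar{t}(k)=0$ if $s_2(k)$ is odd. The sequence $m(n)$, $n \ge 0$, is defined by $m(2k) = \bar{t}(k)$ and $m(2k+1) = 0$ for all $k \ge 0$. The sequence $u$ is OEIS A001285 ($1,2,2,1,2,1,1,2,\ldots$) and $c$ is OEIS A029886, indexed from $n=0$: $1,4,8,10,12,14,15,\ldots$. -}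

module Defs where

open import Data.Bool.Base using (if_then_else_)
open import Data.Digit using (toNatDigits)
open import Data.List.Base using ([]; _∷_; filter; length; map; sum; upTo)
open import Data.Nat.Base using (ℕ; suc; _+_; _*_; _∸_; _/_)
open import Data.Nat.DivMod using (m*n/n≡m)
open import Data.Nat.Divisibility using (_∣?_; m∣m*n; ∣m+n∣m⇒∣n; ∣1⇒≡1)
open import Data.Nat.Properties using (_≟_; *-comm)
open import Relation.Binary.PropositionalEquality using (_≡_; refl; trans; cong)
open import Relation.Nullary.Decidable using (does; dec-true; dec-false)
open import Relation.Nullary.Negation using (contradiction)

s₂ : ℕ → ℕ
s₂ k = length (filter (_≟ 1) (toNatDigits 2 k))

t̄ : ℕ → ℕ
t̄ k = if does (2 ∣? s₂ k) then 1 else 0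

m : ℕ → ℕ
m n = if does (2 ∣? n) then t̄ (n / 2) else 0

m-even : ∀ k → m (2 * k) ≡ t̄ k
m-even k rewrite dec-true (2 ∣? 2 * k) (m∣m*n k) =
  cong t̄ (trans (cong (_/ 2) (*-comm 2 k)) (m*n/n≡m k 2))

m-odd : ∀ k → m (2 * k + 1) ≡ 0
m-odd k rewrite dec-false (2 ∣? 2 * k + 1)
  (λ 2∣ → contradiction (∣1⇒≡1 (∣m+n∣m⇒∣n 2∣ (m∣m*n k))) λ ()) = refl

-- The Thue–Morse sequence over {1, 2}, OEIS A001285.
u : ℕ → ℕ
u n = if does (2 ∣? s₂ n) then 1 else 2

-- OEIS A029886.
c : ℕ → ℕ
c n = sum (map (λ i → u i * u (n ∸ i)) (upTo (suc n)))

u-values : map u (upTo 8) ≡ 1 ∷ 2 ∷ 2 ∷ 1 ∷ 2 ∷ 1 ∷ 1 ∷ 2 ∷ []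
u-values = refl

c-values : map c (upTo 7) ≡ 1 ∷ 4 ∷ 8 ∷ 10 ∷ 12 ∷ 14 ∷ 15 ∷ []
c-values = refl

{-# OPTIONS --safe #-}
-- Modulo 2 the terms i and n - i of a self-convolution cancel in pairs, so only
-- the middle term u(k)² of c(2k) survives, and nothing survives of c(2k + 1).
module Submission where

open import Defs
open import Data.Bool.Base using (true; false)
open import Data.Fin.Base using (zero; suc)
open import Data.List.Base using (applyUpTo)
open import Data.List.Properties using (map-upTo)
open import Data.Nat.Base using (ℕ; zero; suc; _+_; _*_; _∸_; _%_)
open import Data.Nat.Divisibility using (_∣?_)
open import Data.Nat.DivMod using (_divMod_; result; [m+kn]%n≡m%n; m*n%n≡0)
open import Data.Nat.ListAction using (sum)
open import Data.Nat.Properties using (+-assoc; +-identityʳ; *-comm)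
open import Data.Nat.Tactic.RingSolver using (solve-∀)
open import Function.Base using (_∘_)
open import Relation.Binary.PropositionalEquality
  using (_≡_; refl; trans; cong; module ≡-Reasoning)
open import Relation.Nullary.Decidable using (does)

open ≡-Reasoning

-- The first and last terms of a self-convolution are equal, so dropping both keeps its parity and
-- leaves the self-convolution of the shifted sequence (`self-conv-shift-%2`). Iterating, index 2k
-- shrinks to the middle term, and index 2k + 1 to two equal terms with even sum. For `u` the middle
-- term has the parity of `t̄ k`.

conv : (ℕ → ℕ) → (ℕ → ℕ) → ℕ → ℕ
conv f g n = sum (applyUpTo (λ i → f i * g (n ∸ i)) (suc n))

-- The first term splits off `conv` by computation, the last only by induction. Splitting off the
-- first shifts `f` alone, hence two independent sequences.
conv-last : ∀ f g n → conv f g (suc n) ≡ conv f (g ∘ suc) n + f (suc n) * g 0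
conv-last f g zero = shuffle (f 0 * g 1) (f 1 * g 0)
  where
  shuffle : ∀ a b → a + (b + 0) ≡ a + 0 + b
  shuffle = solve-∀
conv-last f g (suc n) = begin
  f 0 * g (2 + n) + conv (f ∘ suc) g (suc n)
    ≡⟨ cong (f 0 * g (2 + n) +_) (conv-last (f ∘ suc) g n) ⟩
  f 0 * g (2 + n) + (conv (f ∘ suc) (g ∘ suc) n + f (2 + n) * g 0)
    ≡⟨ +-assoc (f 0 * g (2 + n)) _ _ ⟨
  f 0 * g (2 + n) + conv (f ∘ suc) (g ∘ suc) n + f (2 + n) * g 0 ∎

self-conv-shift-%2 : ∀ f n →
  conv f f (2 + n) % 2 ≡ conv (f ∘ suc) (f ∘ suc) n % 2
self-conv-shift-%2 f n = begin
  (f 0 * f (2 + n) + conv (f ∘ suc) f (suc n)) % 2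
    ≡⟨ cong (λ s → (f 0 * f (2 + n) + s) % 2) (conv-last (f ∘ suc) f n) ⟩
  (f 0 * f (2 + n) + (conv (f ∘ suc) (f ∘ suc) n + f (2 + n) * f 0)) % 2
    ≡⟨ cong (_% 2) (pair (f 0) (f (2 + n)) (conv (f ∘ suc) (f ∘ suc) n)) ⟩
  (conv (f ∘ suc) (f ∘ suc) n + f 0 * f (2 + n) * 2) % 2
    ≡⟨ [m+kn]%n≡m%n (conv (f ∘ suc) (f ∘ suc) n) (f 0 * f (2 + n)) 2 ⟩
  conv (f ∘ suc) (f ∘ suc) n % 2 ∎
  where
  pair : ∀ a b s → a * b + (s + b * a) ≡ s + a * b * 2
  pair = solve-∀

-- The induction must vary `f`: after `k` shifts, the value at 0 is the original `f k`.
self-conv-even-%2 : ∀ f k → conv f f (k * 2) % 2 ≡ f k * f k % 2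
self-conv-even-%2 f zero    = cong (_% 2) (+-identityʳ (f 0 * f 0))
self-conv-even-%2 f (suc k) =
  trans (self-conv-shift-%2 f (k * 2)) (self-conv-even-%2 (f ∘ suc) k)

self-conv-odd-%2 : ∀ f k → conv f f (suc (k * 2)) % 2 ≡ 0
self-conv-odd-%2 f zero    =
  trans (cong (_% 2) (pair (f 0) (f 1))) (m*n%n≡0 (f 0 * f 1) 2)
  where
  pair : ∀ a b → a * b + (b * a + 0) ≡ a * b * 2
  pair = solve-∀
self-conv-odd-%2 f (suc k) =
  trans (self-conv-shift-%2 f (suc (k * 2))) (self-conv-odd-%2 (f ∘ suc) k)

-- Passes to `applyUpTo`, whose tail unfolds to the same sum for `f ∘ suc`.
c≡conv : ∀ n → c n ≡ conv u u n
c≡conv n = cong sum (map-upTo (λ i → u i * u (n ∸ i)) (suc n))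

-- Both sides branch on the same test: the squares 1 and 4 face the values 1 and 0.
u²≡t̄-%2 : ∀ k → u k * u k % 2 ≡ t̄ k % 2
u²≡t̄-%2 k with does (2 ∣? s₂ k)
... | true  = refl
... | false = refl

lemma4 : ∀ (n : ℕ) → c n % 2 ≡ m n % 2
lemma4 n with n divMod 2
... | result k zero refl = begin
  c (k * 2) % 2          ≡⟨ cong (_% 2) (c≡conv (k * 2)) ⟩
  conv u u (k * 2) % 2   ≡⟨ self-conv-even-%2 u k ⟩
  u k * u k % 2          ≡⟨ u²≡t̄-%2 k ⟩
  t̄ k % 2                ≡⟨ cong (_% 2) (m-even k) ⟨
  m (2 * k) % 2          ≡⟨ cong (λ j → m j % 2) (*-comm 2 k) ⟩
  m (k * 2) % 2          ∎
... | result k (suc zero) refl = begin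
  c (1 + k * 2) % 2         ≡⟨ cong (_% 2) (c≡conv (1 + k * 2)) ⟩
  conv u u (1 + k * 2) % 2  ≡⟨ self-conv-odd-%2 u k ⟩
  0                         ≡⟨ cong (_% 2) (m-odd k) ⟨
  m (2 * k + 1) % 2         ≡⟨ cong (λ j → m j % 2) (reorder k) ⟩
  m (1 + k * 2) % 2         ∎
  where
  reorder : ∀ k → 2 * k + 1 ≡ 1 + k * 2
  reorder = solve-∀
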